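{- Let $k\ge 12$ be an integer divisible by $6$, and let $V=\binom{[\frac{7}{3}k]}{k}$ be the family of all $k$-element subsets of $[\frac{7}{3}k]=\{1,\dots,\frac{7}{3}k\}$. Then in every red/blue edge-coloring of the complete graph on vertex set $V$ there is a monochromatic triangle $ABC$ with $A,B,C\in V$ and $A\cap B\cap C=\emptyset$.
   Context: $\binom{[n]}{k}$ denotes the set of all $k$-element subsets of $[n]=\{1,\dots,n\}$. A triangle $ABC$ is monochromatic if its three edges $AB,BC,CA$ all receive the same color. -}

module Defs where

open import Data.Nat using (ℕ; _*_)
open import Data.Bool using (Bool)
open import Data.Fin.Subset using (Subset; ∣_∣; _∩_; ⊥)
open import Data.Product using (_×_; ∃-syntax)
open import Relation.Binary.PropositionalEquality using (_≡_; _≢_)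

IsKSubset : {n : ℕ} → ℕ → Subset n → Set
IsKSubset k A = ∣ A ∣ ≡ k

-- A red/blue edge-colouring of the complete graph on binom([n],k):
-- a colour for each ordered pair, symmetric, so it is a colouring of unordered edges
-- (values on loops / non-k-subsets are irrelevant).
Symmetric : {n : ℕ} → (Subset n → Subset n → Bool) → Set
Symmetric {n} c = (A B : Subset n) → c A B ≡ c B A

HasDisjointMonoTriangle : (n k : ℕ) → (Subset n → Subset n → Bool) → Set
HasDisjointMonoTriangle n k c =
  ∃[ A ] ∃[ B ] ∃[ C ]
    (IsKSubset k A × IsKSubset k B × IsKSubset k C
    × A ≢ B × B ≢ C × A ≢ C
    × c A B ≡ c B C × c B C ≡ c A C
    × (A ∩ B ∩ C) ≡ ⊥)

{-# OPTIONS --safe #-}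

-- Blowing up each point m times reduces the claim to 6-subsets of [14].  Fix A
-- and colour every other set B by the colour of the edge AB.  If B, C, D have the same
-- colour and all four triples from A, B, C, D have empty intersection, then one of
-- the triangles ABC, ABD, ACD, BCD is monochromatic.  So it suffices to show that this
-- 3-uniform hypergraph on the sets B is not 2-colourable, for A = [6].
--
-- Write B = (T , U) with T ⊆ A and U ⊆ W = [14] ∖ A.  Let T be a cyclic interval
-- of length 2 in A and U a union of two of four fixed pairs partitioning W.
-- If (T , U) and (T′ , U) have different colours for consecutive T, T′, take three sets
-- (t , ∁ U ∪ u) with distinct t ∉ T ∪ T′ and distinct u ∈ U: two of them share a
-- colour, and form an edge with (T , U) or (T′ , U).  Hence the colour of (T , U) depends
-- only on U, giving a 2-colouring of the edges of K₄ on the four pairs.  In it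
-- opposite edges differ in colour and no triangle is monochromatic, which is impossible.
module Submission where

open import Defs
open import Data.Nat using (ℕ; zero; suc; _+_; _*_; _≥_)
import Data.Nat as ℕ
open import Data.Nat.Properties using (*-identityˡ)
open import Data.Nat.DivMod using (_mod_)
open import Data.Bool using (Bool; true; false)
import Data.Bool as Bool
open import Data.Bool.Properties using (¬-not)
open import Data.Fin using (Fin; toℕ; combine)
open import Data.Fin.Patterns using (0F; 1F; 2F; 3F)
import Data.Fin as Fin
open import Data.Fin.Properties using (all?)
open import Data.Fin.Subset using (Subset; ∣_∣; _∩_; _∪_; ∁; ⁅_⁆; ⊥; ⊤)
open import Data.Fin.Subset.Properties using (anySubset?)
open import Data.Product using (_×_; _,_; proj₂)
open import Data.Vec using ([]; _∷_; _++_; replicate)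
open import Data.Vec.Properties using (≡-dec; ∷-injectiveˡ; ++-injective; zipWith-++)
import Data.Empty as Empty
open import Function using (_∘_)
open import Relation.Nullary using (¬_; Dec; yes; no)
open import Relation.Nullary.Decidable
  using (True; _×-dec_; _→-dec_; ¬?; toWitness; decidable-stable)
open import Relation.Binary.PropositionalEquality
  using (_≡_; _≢_; refl; sym; trans; cong; cong₂; module ≡-Reasoning)

private variable
  n k : ℕ

blowUp : (m : ℕ) → Subset n → Subset (n * m)
blowUp m []      = []
blowUp m (b ∷ S) = replicate m b ++ blowUp m S

∣replicate-++∣ : ∀ m b (S : Subset n) →
  ∣ replicate m b ++ S ∣ ≡ ∣ b ∷ [] ∣ * m + ∣ S ∣
∣replicate-++∣ zero    true  S = refl
∣replicate-++∣ zero    false S = refl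
∣replicate-++∣ (suc m) true  S = cong suc (∣replicate-++∣ m true S)
∣replicate-++∣ (suc m) false S = ∣replicate-++∣ m false S

∣blowUp∣ : ∀ m (S : Subset n) → ∣ blowUp m S ∣ ≡ ∣ S ∣ * m
∣blowUp∣ m []          = refl
∣blowUp∣ m (true ∷ S)  = begin
  ∣ replicate m true ++ blowUp m S ∣ ≡⟨ ∣replicate-++∣ m true (blowUp m S) ⟩
  1 * m + ∣ blowUp m S ∣             ≡⟨ cong₂ _+_ (*-identityˡ m) (∣blowUp∣ m S) ⟩
  m + ∣ S ∣ * m                      ∎
  where open ≡-Reasoning
∣blowUp∣ m (false ∷ S) =
  trans (∣replicate-++∣ m false (blowUp m S)) (∣blowUp∣ m S)

replicate-∩ : ∀ m a b → replicate m a ∩ replicate m b ≡ replicate m (a Bool.∧ b)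
replicate-∩ zero    a b = refl
replicate-∩ (suc m) a b = cong (a Bool.∧ b ∷_) (replicate-∩ m a b)

blowUp-∩ : ∀ m (S T : Subset n) → blowUp m S ∩ blowUp m T ≡ blowUp m (S ∩ T)
blowUp-∩ m []      []      = refl
blowUp-∩ m (a ∷ S) (b ∷ T) = trans
  (zipWith-++ Bool._∧_ (replicate m a) (blowUp m S) (replicate m b) (blowUp m T))
  (cong₂ _++_ (replicate-∩ m a b) (blowUp-∩ m S T))

replicate-++-replicate : ∀ m {b : Bool} → replicate m b ++ replicate n b ≡ replicate (m + n) b
replicate-++-replicate zero    = refl
replicate-++-replicate (suc m) = cong (_ ∷_) (replicate-++-replicate m)

blowUp-⊥ : ∀ n m → blowUp m (⊥ {n}) ≡ ⊥
blowUp-⊥ zero    m = refl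
blowUp-⊥ (suc n) m = trans (cong (⊥ ++_) (blowUp-⊥ n m)) (replicate-++-replicate m)

-- With factor `suc m` every block is nonempty, so its first entry recovers the original bit.
blowUp-injective : ∀ m (S T : Subset n) → blowUp (suc m) S ≡ blowUp (suc m) T → S ≡ T
blowUp-injective m []      []      _  = refl
blowUp-injective m (a ∷ S) (b ∷ T) eq =
  cong₂ _∷_ (∷-injectiveˡ eq)
    (blowUp-injective m S T (proj₂ (++-injective (replicate (suc m) a) (replicate (suc m) b) eq)))

blowUp-triangle : ∀ m (c : Subset (n * suc m) → Subset (n * suc m) → Bool) →
  HasDisjointMonoTriangle n k (λ S T → c (blowUp (suc m) S) (blowUp (suc m) T)) →
  HasDisjointMonoTriangle (n * suc m) (k * suc m) c
blowUp-triangle {n} {k} m c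
  (A , B , C , ∣A∣ , ∣B∣ , ∣C∣ , A≢B , B≢C , A≢C , AB≡BC , BC≡AC , A∩B∩C≡⊥) =
  blow A , blow B , blow C , size A ∣A∣ , size B ∣B∣ , size C ∣C∣ ,
  A≢B ∘ inj A B , B≢C ∘ inj B C , A≢C ∘ inj A C , AB≡BC , BC≡AC , (begin
    blow A ∩ blow B ∩ blow C ≡⟨ cong (blow A ∩_) (blowUp-∩ (suc m) B C) ⟩
    blow A ∩ blow (B ∩ C)    ≡⟨ blowUp-∩ (suc m) A (B ∩ C) ⟩
    blow (A ∩ B ∩ C)         ≡⟨ cong blow A∩B∩C≡⊥ ⟩
    blow ⊥                   ≡⟨ blowUp-⊥ n (suc m) ⟩
    ⊥                        ∎)
  where
  open ≡-Reasoning
  blow = blowUp {n} (suc m)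
  inj  = blowUp-injective {n} m
  size : ∀ S → IsKSubset k S → IsKSubset (k * suc m) (blow S)
  size S ∣S∣≡k = trans (∣blowUp∣ (suc m) S) (cong (_* suc m) ∣S∣≡k)

DisjointTriangle : ℕ → (A B C : Subset n) → Set
DisjointTriangle k A B C =
  IsKSubset k A × IsKSubset k B × IsKSubset k C
  × A ≢ B × B ≢ C × A ≢ C × (A ∩ B ∩ C) ≡ ⊥

_≟_ : (A B : Subset n) → Dec (A ≡ B)
_≟_ = ≡-dec Bool._≟_

disjointTriangle? : ∀ k (A B C : Subset n) → Dec (DisjointTriangle k A B C)
disjointTriangle? k A B C =
  ∣ A ∣ ℕ.≟ k ×-dec ∣ B ∣ ℕ.≟ k ×-dec ∣ C ∣ ℕ.≟ k
  ×-dec ¬? (A ≟ B) ×-dec ¬? (B ≟ C) ×-dec ¬? (A ≟ C) ×-dec (A ∩ B ∩ C) ≟ ⊥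

-- Exhaustive search makes the claim stable under double negation, so it can be proved by
-- contradiction constructively.
hasDisjointMonoTriangle? : ∀ n k c → Dec (HasDisjointMonoTriangle n k c)
hasDisjointMonoTriangle? n k c =
  anySubset? λ A → anySubset? λ B → anySubset? λ C →
  ∣ A ∣ ℕ.≟ k ×-dec ∣ B ∣ ℕ.≟ k ×-dec ∣ C ∣ ℕ.≟ k
  ×-dec ¬? (A ≟ B) ×-dec ¬? (B ≟ C) ×-dec ¬? (A ≟ C)
  ×-dec c A B Bool.≟ c B C ×-dec c B C Bool.≟ c A C ×-dec (A ∩ B ∩ C) ≟ ⊥

DisjointTetrahedron : ℕ → (A B C D : Subset n) → Set
DisjointTetrahedron k A B C D =
  DisjointTriangle k A B C × DisjointTriangle k A B D
  × DisjointTriangle k A C D × DisjointTriangle k B C D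

disjointTetrahedron? : ∀ k (A B C D : Subset n) → Dec (DisjointTetrahedron k A B C D)
disjointTetrahedron? k A B C D =
  disjointTriangle? k A B C ×-dec disjointTriangle? k A B D
  ×-dec disjointTriangle? k A C D ×-dec disjointTriangle? k B C D

≢-≢⇒≡ : {x y z : Bool} → x ≢ z → y ≢ z → x ≡ y
≢-≢⇒≡ x≢z y≢z = trans (¬-not x≢z) (sym (¬-not y≢z))

module _ {c : Subset n → Subset n → Bool} (noMono : ¬ HasDisjointMonoTriangle n k c) where

  noMonoTriangle : ∀ {A B C} → DisjointTriangle k A B C →
    c A B ≡ c B C → c B C ≢ c A C
  noMonoTriangle (∣A∣ , ∣B∣ , ∣C∣ , A≢B , B≢C , A≢C , ∩≡⊥) AB≡BC BC≡AC =
    noMono (_ , _ , _ , ∣A∣ , ∣B∣ , ∣C∣ , A≢B , B≢C , A≢C , AB≡BC , BC≡AC , ∩≡⊥)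

  -- Each of BC, BD, CD closes a triangle with A, so it must avoid the colour shared by AB, AC, AD;
  -- then BCD is monochromatic.
  noMonoStar : ∀ {A B C D} → DisjointTetrahedron k A B C D →
    c A B ≡ c A C → c A C ≢ c A D
  noMonoStar {A} {B} {C} {D} (ABC , ABD , ACD , BCD) AB≡AC AC≡AD =
    noMonoTriangle BCD (≢-≢⇒≡ BC≢AB CD≢AB) (≢-≢⇒≡ CD≢AB BD≢AB)
    where
    AB≡AD = trans AB≡AC AC≡AD
    BC≢AB : c B C ≢ c A B
    BC≢AB eq = noMonoTriangle ABC (sym eq) (trans eq AB≡AC)
    BD≢AB : c B D ≢ c A B
    BD≢AB eq = noMonoTriangle ABD (sym eq) (trans eq AB≡AD)
    CD≢AB : c C D ≢ c A B
    CD≢AB eq = noMonoTriangle ACD (trans (sym AB≡AC) (sym eq)) (trans eq AB≡AD)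

A₀ : Subset 14
A₀ = ⊤ {6} ++ ⊥ {8}

Edge : (B C D : Subset 14) → Set
Edge = DisjointTetrahedron 6 A₀

edge? : ∀ B C D → Dec (Edge B C D)
edge? = disjointTetrahedron? 6 A₀

point : ℕ → Subset 6
point i = ⁅ i mod 6 ⁆

arc : ℕ → Subset 6
arc i = point i ∪ point (suc i)

pair : Fin 4 → Subset 8
pair x = ⁅ combine {n = 2} x 0F ⁆ ∪ ⁅ combine {n = 2} x 1F ⁆

arcSet : ℕ → Fin 4 → Fin 4 → Subset 14
arcSet i x y = arc i ++ (pair x ∪ pair y)

pointSet : ℕ → Fin 4 → Fin 4 → Fin 8 → Subset 14
pointSet i x y u = point i ++ (∁ (pair x ∪ pair y) ∪ ⁅ u ⁆)

-- The arcs `i` and `suc i` cover `i`, `i + 1`, `i + 2` modulo 6, which leaves these three points.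
-- The last arguments are three of the four elements of `pair x ∪ pair y`.
q₀ q₁ q₂ : ℕ → Fin 4 → Fin 4 → Subset 14
q₀ i x y = pointSet (3 + i) x y (combine {n = 2} x 0F)
q₁ i x y = pointSet (4 + i) x y (combine {n = 2} x 1F)
q₂ i x y = pointSet (5 + i) x y (combine {n = 2} y 0F)

CommonEdge : (P P′ Q R : Subset 14) → Set
CommonEdge P P′ Q R = Edge P Q R × Edge P′ Q R

LinkTriangle : ℕ → Fin 4 → Fin 4 → Set
LinkTriangle i x y = Common (q₀ i x y) (q₁ i x y)
  × Common (q₁ i x y) (q₂ i x y) × Common (q₀ i x y) (q₂ i x y)
  where Common = CommonEdge (arcSet i x y) (arcSet (suc i) x y)

-- Inside `A₀` the points differ and avoid both arcs; outside it, an arc set confines intersections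
-- to `pair x ∪ pair y`, where the `q` sets hold distinct single elements. All cases are checked by
-- evaluation.
linkTriangle : ∀ (i x y : Fin 4) → x ≢ y → LinkTriangle (toℕ i) x y
linkTriangle = toWitness {a? = all? λ i → all? λ x → all? λ y →
  ¬? (x Fin.≟ y) →-dec linkTriangle? (toℕ i) x y} _
  where
  linkTriangle? : ∀ i x y → Dec (LinkTriangle i x y)
  linkTriangle? i x y = common? (q₀ i x y) (q₁ i x y)
    ×-dec common? (q₁ i x y) (q₂ i x y) ×-dec common? (q₀ i x y) (q₂ i x y)
    where
    common? = λ Q R → edge? (arcSet i x y) Q R ×-dec edge? (arcSet (suc i) x y) Q R

module _ (f : Subset 14 → Bool)
         (noMono : ∀ {B C D} → Edge B C D → f B ≡ f C → f C ≢ f D) where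

  -- With two colours, `f Q` equals `f P` or `f P′`, so `f Q ≡ f R` would make one of the two edges
  -- monochromatic.
  common⇒≢ : ∀ {P P′ Q R} → f P ≢ f P′ → CommonEdge P P′ Q R → f Q ≢ f R
  common⇒≢ {P} {P′} {Q} P≢P′ (PQR , P′QR) Q≡R with f P Bool.≟ f Q
  ... | yes P≡Q = noMono PQR P≡Q Q≡R
  ... | no  P≢Q = noMono P′QR (≢-≢⇒≡ (P≢P′ ∘ sym) (P≢Q ∘ sym)) Q≡R

  arcSet-step : ∀ (i : Fin 4) {x y} → x ≢ y →
    f (arcSet (toℕ i) x y) ≡ f (arcSet (suc (toℕ i)) x y)
  arcSet-step i x≢y = decidable-stable (_ Bool.≟ _) λ P≢P′ →
    let q₀q₁ , q₁q₂ , q₀q₂ = linkTriangle i _ _ x≢y in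
    -- `q₀` and `q₁` both differ in colour from `q₂`, so they agree, which their common edges
    -- forbid.
    common⇒≢ P≢P′ q₀q₁
      (≢-≢⇒≡ (common⇒≢ P≢P′ q₀q₂) (common⇒≢ P≢P′ q₁q₂))

  colour : Fin 4 → Fin 4 → Bool
  colour x y = f (arcSet 0 x y)

  arcSet₂ : ∀ {x y} → x ≢ y → colour x y ≡ f (arcSet 2 x y)
  arcSet₂ x≢y = trans (arcSet-step 0F x≢y) (arcSet-step 1F x≢y)

  arcSet₄ : ∀ {x y} → x ≢ y → colour x y ≡ f (arcSet 4 x y)
  arcSet₄ x≢y = trans (arcSet₂ x≢y) (trans (arcSet-step 2F x≢y) (arcSet-step 3F x≢y))

  -- Arcs 0, 2, 4 are disjoint, so three edges of K₄ qualify as soon as no vertex lies on all of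
  -- them. The `True` arguments evaluate at concrete indices.
  noMonoPairs : ∀ x y x′ y′ x″ y″ →
    {True (¬? (x′ Fin.≟ y′))} → {True (¬? (x″ Fin.≟ y″))} →
    {True (edge? (arcSet 0 x y) (arcSet 2 x′ y′) (arcSet 4 x″ y″))} →
    colour x y ≡ colour x′ y′ → colour x′ y′ ≢ colour x″ y″
  noMonoPairs x y x′ y′ x″ y″ {≢′} {≢″} {e} eq eq′ =
    noMono (toWitness e) (trans eq (arcSet₂ x′≢y′))
      (trans (sym (arcSet₂ x′≢y′)) (trans eq′ (arcSet₄ (toWitness ≢″))))
    where x′≢y′ = toWitness ≢′

  -- The pair 01 may be used twice, since arcs 0 and 4 give two different sets.
  01≢23 : colour 0F 1F ≢ colour 2F 3F
  01≢23 eq = noMonoPairs 0F 1F 2F 3F 0F 1F eq (sym eq)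

  02≢13 : colour 0F 2F ≢ colour 1F 3F
  02≢13 eq = noMonoPairs 0F 2F 1F 3F 0F 2F eq (sym eq)

  03≢12 : colour 0F 3F ≢ colour 1F 2F
  03≢12 eq = noMonoPairs 0F 3F 1F 2F 0F 3F eq (sym eq)

  no-2-colouring : Empty.⊥
  no-2-colouring with colour 0F 1F Bool.≟ colour 0F 2F
  -- The star at 0 gets one colour, so the opposite triangle 123 gets the other.
  ... | yes 01≡02 = noMonoPairs 2F 3F 1F 3F 1F 2F 23≡13 13≡12
    where
    02≡03 = ≢-≢⇒≡ (noMonoPairs 0F 1F 0F 2F 1F 2F 01≡02) 03≢12
    23≡13 = ≢-≢⇒≡ (01≢23 ∘ sym) (λ 13≡01 → 02≢13 (sym (trans 13≡01 01≡02)))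
    13≡12 = ≢-≢⇒≡ (02≢13 ∘ sym) (λ 12≡02 → 03≢12 (sym (trans 12≡02 02≡03)))
  -- Opposite edges give 13 the colour of 01 and 23 that of 02; triangle 013 then forces 03 to match
  -- 02, making 023 monochromatic.
  ... | no 01≢02 = noMonoPairs 2F 3F 0F 2F 0F 3F 23≡02 02≡03
    where
    01≡13 = ≢-≢⇒≡ 01≢02 (02≢13 ∘ sym)
    23≡02 = ≢-≢⇒≡ (01≢23 ∘ sym) (01≢02 ∘ sym)
    02≡03 = ≢-≢⇒≡ 02≢13 (λ 03≡13 → noMonoPairs 0F 1F 1F 3F 0F 3F 01≡13 (sym 03≡13))

hasDisjointMonoTriangle-14-6 : ∀ c → HasDisjointMonoTriangle 14 6 c
hasDisjointMonoTriangle-14-6 c = decidable-stable (hasDisjointMonoTriangle? 14 6 c)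
  λ noMono → no-2-colouring (c A₀) (noMonoStar noMono)

theorem1p5 : (m : ℕ) → m ≥ 2 → (c : Subset (14 * m) → Subset (14 * m) → Bool) →
    Symmetric c → HasDisjointMonoTriangle (14 * m) (6 * m) c
theorem1p5 (suc m) _ c _ = blowUp-triangle m c (hasDisjointMonoTriangle-14-6 _)
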